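{- For every positive integer $t$ there exists a positive integer $k$ such that $\mathrm{bt}(G_k)\ge t$, where $G_k$ is the graph obtained from the complete graph $K_k$ by subdividing every edge into a path of two edges, and $\mathrm{bt}$ denotes book thickness.
   Context: The graph $G_k$ is formed from the complete $k$-vertex graph $K_k$ by subdividing every edge into a path of two edges. Equivalently, the vertices of $G_k$ are the one-element and two-element subsets of a $k$-element set, with an edge between two distinct such subsets exactly when one is contained in the other. Thus $G_k$ has $k+\binom{k}{2}$ vertices and $2\binom{k}{2}$ edges. A straight-line drawing of a graph places the vertices at distinct points of the plane $\mathbb{R}^2$ and draws each edge as the straight line segment between the points representing its endpoints. Two edges cross if their segments share a point that is not a common endpoint of the two edges. The book thickness $\mathrm{bt}(G)$ of a graph $G$ is the minimum number of layers in a straight-line drawing of $G$ in the plane in which each edge is assigned to a single layer and no two edges in the same layer cross, with the further restriction that the vertices of $G$ are placed in convex position (i.e. they are the vertices of a strictly convex polygon). (Edges in different layers may cross; the vertex positions are the same for all layers.) -}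

module Defs where

open import Data.Fin.Base using (Fin; toℕ)
open import Data.Fin.Subset using (Subset; ∣_∣; _⊆_)
open import Data.Nat.Base as ℕ using (ℕ; zero; suc)
import Data.Nat.Properties as ℕ
open import Data.Nat.DivMod using (_mod_)
open import Data.Product using (Σ; ∃-syntax; _×_; _,_)
open import Data.Rational.Base as ℚ using (ℚ; 0ℚ; 1ℚ; ½)
import Data.Rational.Properties as ℚ
open import Data.Rational.Solver using (module +-*-Solver)
open import Data.Sum.Base using (_⊎_; swap)
open import Function.Base using (_∘_)
open import Function.Bundles using (_⤖_; module Bijection)
open import Relation.Binary.Core using (Rel)
open import Relation.Binary.Definitions using (Symmetric; Irreflexive)
open import Relation.Binary.PropositionalEquality
  using (_≡_; _≢_; refl; sym; cong; subst)
open import Relation.Nullary.Negation.Core using (¬_)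

-- Real numbers are Cauchy sequences of rationals under the setoid
-- equality _≈_.

IsCauchy : (ℕ → ℚ) → Set
IsCauchy x = ∀ ε → 0ℚ ℚ.< ε →
  ∃[ N ] (∀ m n → N ℕ.≤ m → N ℕ.≤ n → ℚ.∣ x m ℚ.- x n ∣ ℚ.< ε)

record ℝ : Set where
  constructor mkℝ
  field
    seq      : ℕ → ℚ
    isCauchy : IsCauchy seq

open ℝ public

infix 4 _≈_ _<_ _≤_

_≈_ : Rel ℝ _
x ≈ y = ∀ ε → 0ℚ ℚ.< ε →
  ∃[ N ] (∀ n → N ℕ.≤ n → ℚ.∣ seq x n ℚ.- seq y n ∣ ℚ.< ε)

_<_ : Rel ℝ _
x < y = ∃[ ε ] (0ℚ ℚ.< ε ×
  ∃[ N ] (∀ n → N ℕ.≤ n → seq x n ℚ.+ ε ℚ.≤ seq y n))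

_≤_ : Rel ℝ _
x ≤ y = ¬ (y < x)

fromℚ : ℚ → ℝ
fromℚ q = mkℝ (λ _ → q) λ ε 0<ε → 0 , λ _ _ _ _ →
  subst (λ r → ℚ.∣ r ∣ ℚ.< ε) (sym (ℚ.+-inverseʳ q)) 0<ε

0ℝ 1ℝ : ℝ
0ℝ = fromℚ 0ℚ
1ℝ = fromℚ 1ℚ

private
  open ℚ.≤-Reasoning

  module _ where
    open +-*-Solver

    +-difference : ∀ a b c d →
      (a ℚ.+ b) ℚ.- (c ℚ.+ d) ≡ (a ℚ.- c) ℚ.+ (b ℚ.- d)
    +-difference = solve 4 (λ a b c d →
      (a :+ b) :- (c :+ d) := (a :- c) :+ (b :- d)) refl

    *-difference : ∀ a b c d →
      a ℚ.* b ℚ.- c ℚ.* d ≡ a ℚ.* (b ℚ.- d) ℚ.+ d ℚ.* (a ℚ.- c)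
    *-difference = solve 4 (λ a b c d →
      a :* b :- c :* d := a :* (b :- d) :+ d :* (a :- c)) refl

    subtract-add : ∀ a b → a ≡ (a ℚ.- b) ℚ.+ b
    subtract-add = solve 2 (λ a b → a := (a :- b) :+ b) refl

  half : ∀ ε → 0ℚ ℚ.< ε → 0ℚ ℚ.< ½ ℚ.* ε
  half ε 0<ε = begin-strict
    0ℚ       ≡⟨ ℚ.*-zeroʳ ½ ⟨
    ½ ℚ.* 0ℚ <⟨ ℚ.*-monoʳ-<-pos ½ 0<ε ⟩
    ½ ℚ.* ε  ∎

  half+half : ∀ ε → ½ ℚ.* ε ℚ.+ ½ ℚ.* ε ≡ ε
  half+half ε = begin-equality
    ½ ℚ.* ε ℚ.+ ½ ℚ.* ε ≡⟨ ℚ.*-distribʳ-+ ε ½ ½ ⟨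
    1ℚ ℚ.* ε            ≡⟨ ℚ.*-identityˡ ε ⟩
    ε                   ∎

  +-cauchy : ∀ {x y} → IsCauchy x → IsCauchy y →
             IsCauchy (λ n → x n ℚ.+ y n)
  +-cauchy {x} {y} cx cy ε 0<ε
    with cx (½ ℚ.* ε) (half ε 0<ε) | cy (½ ℚ.* ε) (half ε 0<ε)
  ... | M , hM | N , hN = M ℕ.⊔ N , λ m n m≥ n≥ → begin-strict
    ℚ.∣ (x m ℚ.+ y m) ℚ.- (x n ℚ.+ y n) ∣
      ≡⟨ cong ℚ.∣_∣ (+-difference (x m) (y m) (x n) (y n)) ⟩
    ℚ.∣ (x m ℚ.- x n) ℚ.+ (y m ℚ.- y n) ∣
      ≤⟨ ℚ.∣p+q∣≤∣p∣+∣q∣ (x m ℚ.- x n) (y m ℚ.- y n) ⟩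
    ℚ.∣ x m ℚ.- x n ∣ ℚ.+ ℚ.∣ y m ℚ.- y n ∣
      <⟨ ℚ.+-mono-< (hM m n (ℕ.m⊔n≤o⇒m≤o M N m≥) (ℕ.m⊔n≤o⇒m≤o M N n≥))
                    (hN m n (ℕ.m⊔n≤o⇒n≤o M N m≥) (ℕ.m⊔n≤o⇒n≤o M N n≥)) ⟩
    ½ ℚ.* ε ℚ.+ ½ ℚ.* ε
      ≡⟨ half+half ε ⟩
    ε ∎

  neg-cauchy : ∀ {x} → IsCauchy x → IsCauchy (λ n → ℚ.- x n)
  neg-cauchy {x} cx ε 0<ε with cx ε 0<ε
  ... | N , h = N , λ m n m≥ n≥ → begin-strict
    ℚ.∣ ℚ.- x m ℚ.- ℚ.- x n ∣
      ≡⟨ cong ℚ.∣_∣ (ℚ.neg-distrib-+ (x m) (ℚ.- x n)) ⟨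
    ℚ.∣ ℚ.- (x m ℚ.- x n) ∣
      ≡⟨ ℚ.∣-p∣≡∣p∣ (x m ℚ.- x n) ⟩
    ℚ.∣ x m ℚ.- x n ∣
      <⟨ h m n m≥ n≥ ⟩
    ε ∎

  bounded : ∀ {x} → IsCauchy x →
            ∃[ B ] (ℚ.Positive B × ∃[ N ] (∀ n → N ℕ.≤ n → ℚ.∣ x n ∣ ℚ.≤ B))
  bounded {x} cx with cx 1ℚ (ℚ.positive⁻¹ 1ℚ)
  ... | N , h = 1ℚ ℚ.+ ℚ.∣ x N ∣ , ℚ.positive B>0 , N , λ n n≥ → begin
    ℚ.∣ x n ∣
      ≡⟨ cong ℚ.∣_∣ (subtract-add (x n) (x N)) ⟩
    ℚ.∣ (x n ℚ.- x N) ℚ.+ x N ∣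
      ≤⟨ ℚ.∣p+q∣≤∣p∣+∣q∣ (x n ℚ.- x N) (x N) ⟩
    ℚ.∣ x n ℚ.- x N ∣ ℚ.+ ℚ.∣ x N ∣
      ≤⟨ ℚ.+-monoˡ-≤ ℚ.∣ x N ∣ (ℚ.<⇒≤ (h n N n≥ ℕ.≤-refl)) ⟩
    1ℚ ℚ.+ ℚ.∣ x N ∣ ∎
    where
    B>0 : 0ℚ ℚ.< 1ℚ ℚ.+ ℚ.∣ x N ∣
    B>0 = ℚ.+-mono-<-≤ (ℚ.positive⁻¹ 1ℚ) (ℚ.0≤∣p∣ (x N))

  quotient : ∀ D → ℚ.Positive D → ∀ ε → 0ℚ ℚ.< ε →
             ∃[ δ ] (0ℚ ℚ.< δ × D ℚ.* δ ≡ ε)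
  quotient D D>0 ε 0<ε = D⁻¹ ℚ.* ε , 0<D⁻¹ε , D*D⁻¹ε
    where
    D⁻¹ : ℚ
    D⁻¹ = (ℚ.1/ D) {{ℚ.pos⇒nonZero D {{D>0}}}}
    0<D⁻¹ε : 0ℚ ℚ.< D⁻¹ ℚ.* ε
    0<D⁻¹ε = begin-strict
      0ℚ           ≡⟨ ℚ.*-zeroʳ D⁻¹ ⟨
      D⁻¹ ℚ.* 0ℚ   <⟨ ℚ.*-monoʳ-<-pos D⁻¹ {{ℚ.1/pos⇒pos D {{D>0}}}} 0<ε ⟩
      D⁻¹ ℚ.* ε    ∎
    D*D⁻¹ε : D ℚ.* (D⁻¹ ℚ.* ε) ≡ ε
    D*D⁻¹ε = begin-equality
      D ℚ.* (D⁻¹ ℚ.* ε) ≡⟨ ℚ.*-assoc D D⁻¹ ε ⟨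
      D ℚ.* D⁻¹ ℚ.* ε   ≡⟨ cong (ℚ._* ε) (ℚ.*-inverseʳ D {{ℚ.pos⇒nonZero D {{D>0}}}}) ⟩
      1ℚ ℚ.* ε          ≡⟨ ℚ.*-identityˡ ε ⟩
      ε                 ∎

  ∣*∣-bound : ∀ a b D δ → ℚ.Positive D → ℚ.∣ a ∣ ℚ.≤ D → ℚ.∣ b ∣ ℚ.< δ →
              ℚ.∣ a ℚ.* b ∣ ℚ.< D ℚ.* δ
  ∣*∣-bound a b D δ D>0 a≤D b<δ = begin-strict
    ℚ.∣ a ℚ.* b ∣         ≡⟨ ℚ.∣p*q∣≡∣p∣*∣q∣ a b ⟩
    ℚ.∣ a ∣ ℚ.* ℚ.∣ b ∣   ≤⟨ ℚ.*-monoʳ-≤-nonNeg ℚ.∣ b ∣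
                               {{ℚ.nonNegative (ℚ.0≤∣p∣ b)}} a≤D ⟩
    D ℚ.* ℚ.∣ b ∣         <⟨ ℚ.*-monoʳ-<-pos D {{D>0}} b<δ ⟩
    D ℚ.* δ               ∎

  *-close : ∀ a b c d B C δ → ℚ.Positive B → ℚ.Positive C →
    ℚ.∣ a ∣ ℚ.≤ B → ℚ.∣ d ∣ ℚ.≤ C →
    ℚ.∣ a ℚ.- c ∣ ℚ.< δ → ℚ.∣ b ℚ.- d ∣ ℚ.< δ →
    ℚ.∣ a ℚ.* b ℚ.- c ℚ.* d ∣ ℚ.< (B ℚ.+ C) ℚ.* δ
  *-close a b c d B C δ B>0 C>0 a≤B d≤C ac bd = begin-strict
    ℚ.∣ a ℚ.* b ℚ.- c ℚ.* d ∣
      ≡⟨ cong ℚ.∣_∣ (*-difference a b c d) ⟩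
    ℚ.∣ a ℚ.* (b ℚ.- d) ℚ.+ d ℚ.* (a ℚ.- c) ∣
      ≤⟨ ℚ.∣p+q∣≤∣p∣+∣q∣ (a ℚ.* (b ℚ.- d)) (d ℚ.* (a ℚ.- c)) ⟩
    ℚ.∣ a ℚ.* (b ℚ.- d) ∣ ℚ.+ ℚ.∣ d ℚ.* (a ℚ.- c) ∣
      <⟨ ℚ.+-mono-< (∣*∣-bound a (b ℚ.- d) B δ B>0 a≤B bd)
                    (∣*∣-bound d (a ℚ.- c) C δ C>0 d≤C ac) ⟩
    B ℚ.* δ ℚ.+ C ℚ.* δ
      ≡⟨ ℚ.*-distribʳ-+ δ B C ⟨
    (B ℚ.+ C) ℚ.* δ ∎

  *-cauchy : ∀ {x y} → IsCauchy x → IsCauchy y →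
             IsCauchy (λ n → x n ℚ.* y n)
  *-cauchy {x} {y} cx cy ε 0<ε =
    let B , B>0 , K , hB = bounded {x} cx
        C , C>0 , L , hC = bounded {y} cy
        δ , 0<δ , split  =
          quotient (B ℚ.+ C) (ℚ.pos+pos⇒pos B {{B>0}} C {{C>0}}) ε 0<ε
        M , hM = cx δ 0<δ
        N , hN = cy δ 0<δ
        KL = K ℕ.⊔ L
        MN = M ℕ.⊔ N
    in KL ℕ.⊔ MN , λ m n m≥ n≥ →
      let m≥K  = ℕ.m⊔n≤o⇒m≤o K L (ℕ.m⊔n≤o⇒m≤o KL MN m≥)
          n≥L  = ℕ.m⊔n≤o⇒n≤o K L (ℕ.m⊔n≤o⇒m≤o KL MN n≥)
          m≥MN = ℕ.m⊔n≤o⇒n≤o KL MN m≥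
          n≥MN = ℕ.m⊔n≤o⇒n≤o KL MN n≥
      in subst (ℚ.∣ x m ℚ.* y m ℚ.- x n ℚ.* y n ∣ ℚ.<_) split
        (*-close (x m) (y m) (x n) (y n) B C δ B>0 C>0
          (hB m m≥K) (hC n n≥L)
          (hM m n (ℕ.m⊔n≤o⇒m≤o M N m≥MN) (ℕ.m⊔n≤o⇒m≤o M N n≥MN))
          (hN m n (ℕ.m⊔n≤o⇒n≤o M N m≥MN) (ℕ.m⊔n≤o⇒n≤o M N n≥MN)))

infixl 6 _+_ _-_
infixl 7 _*_
infix  8 -_

_+_ : ℝ → ℝ → ℝ
mkℝ x cx + mkℝ y cy = mkℝ (λ n → x n ℚ.+ y n) (+-cauchy {x} {y} cx cy)

_*_ : ℝ → ℝ → ℝ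
mkℝ x cx * mkℝ y cy = mkℝ (λ n → x n ℚ.* y n) (*-cauchy {x} {y} cx cy)

-_ : ℝ → ℝ
- mkℝ x cx = mkℝ (λ n → ℚ.- x n) (neg-cauchy {x} cx)

_-_ : ℝ → ℝ → ℝ
x - y = x + - y

Point : Set
Point = ℝ × ℝ

infix 4 _≈ₚ_

_≈ₚ_ : Rel Point _
(x₁ , y₁) ≈ₚ (x₂ , y₂) = x₁ ≈ x₂ × y₁ ≈ y₂

_∈[_,_] : Point → Point → Point → Set
p ∈[ (ax , ay) , (bx , by) ] = ∃[ r ] (0ℝ ≤ r × r ≤ 1ℝ ×
  p ≈ₚ ((1ℝ - r) * ax + r * bx , (1ℝ - r) * ay + r * by))

-- Twice the signed area of the triangle: positive exactly when the third
-- point lies strictly to the left of the directed line through the first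
-- two.
orient : Point → Point → Point → ℝ
orient (ax , ay) (bx , by) (cx , cy) =
  (bx - ax) * (cy - ay) - (by - ay) * (cx - ax)

cyclicSuc : ∀ {n} → Fin n → Fin n
cyclicSuc {suc n} i = suc (toℕ i) mod suc n

-- The sides are the segments from p i to p (cyclicSuc i), traversed
-- counterclockwise; every other vertex lies strictly inside the half-plane
-- to the left of each side.  For fewer than three points there is no
-- condition.
StrictlyConvexPolygon : ∀ {n} → (Fin n → Point) → Set
StrictlyConvexPolygon p = ∀ i j → j ≢ i → j ≢ cyclicSuc i →
  0ℝ < orient (p i) (p (cyclicSuc i)) (p j)

-- Listing the vertices of a convex polygon counterclockwise loses no
-- generality, since the enumeration is existentially quantified.
ConvexPosition : {V : Set} → (V → Point) → Set
ConvexPosition {V} pos = ∃[ n ] Σ (Fin n ⤖ V) λ e →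
  StrictlyConvexPolygon (pos ∘ Bijection.to e)

record SimpleGraph : Set₁ where
  infix 4 _~_
  field
    V      : Set
    _~_    : Rel V _
    symm   : Symmetric _~_
    irrefl : Irreflexive _≡_ _~_

module _ (G : SimpleGraph) where
  open SimpleGraph G

  SameEdge : V → V → V → V → Set
  SameEdge u v x y = (u ≡ x × v ≡ y) ⊎ (u ≡ y × v ≡ x)

  Crosses : (V → Point) → V → V → V → V → Set
  Crosses pos u v x y = ∃[ p ]
    ( p ∈[ pos u , pos v ]
    × p ∈[ pos x , pos y ]
    × ¬ (∃[ w ] ((w ≡ u ⊎ w ≡ v) × (w ≡ x ⊎ w ≡ y) × p ≈ₚ pos w)))

  record StraightLineDrawing : Set where
    field
      pos      : V → Point
      distinct : ∀ {u v} → u ≢ v → ¬ (pos u ≈ₚ pos v)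

  record BookDrawing (s : ℕ) : Set where
    field
      drawing : StraightLineDrawing
    open StraightLineDrawing drawing public
    field
      convex    : ConvexPosition pos
      layer     : ∀ {u v} → u ~ v → Fin s
      -- Applied twice, this also makes the layer independent of the proof
      -- of adjacency.
      layer-sym : ∀ {u v} (e : u ~ v) (e′ : v ~ u) → layer e ≡ layer e′
      noncross  : ∀ {u v x y} (e : u ~ v) (f : x ~ y) →
                  ¬ SameEdge u v x y → layer e ≡ layer f →
                  ¬ Crosses pos u v x y

-- The book thickness of G is the least s with a BookDrawing G s, so it is
-- at least t exactly when t is a lower bound of all such s.
infix 4 _≤bt_

_≤bt_ : ℕ → SimpleGraph → Set
t ≤bt G = ∀ {s} → BookDrawing G s → t ℕ.≤ s

-- The complete graph on Fin k with every edge subdivided once: singletons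
-- are the original vertices, and the pair {i , j} is the vertex subdividing
-- the edge between i and j.
G : ℕ → SimpleGraph
G k = record
  { V      = Σ (Subset k) λ S → ∣ S ∣ ≡ 1 ⊎ ∣ S ∣ ≡ 2
  ; _~_    = λ (S , _) (T , _) → S ≢ T × (S ⊆ T ⊎ T ⊆ S)
  ; symm   = λ (S≢T , S⊂T) → (λ T≡S → S≢T (sym T≡S)) , swap S⊂T
  ; irrefl = λ { refl (S≢S , _) → S≢S refl }
  }

{-# OPTIONS --safe #-}
module Submission where

-- In a convex drawing, two edges cross as soon as their ends alternate along the
-- polygon.  By the pigeonhole principle, some K₃₃ inside K_k, with parts x and y
-- and subdivision vertices m, has all its edges x m in one page and all its edges
-- m y in one page.  This two-page drawing is excluded by a parity count in the
-- spirit of van Kampen: whether two arcs cross is an F₂-linear function of the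
-- comparisons of their ends, and for a four-cycle a b a′ b′ of K₃₃ the four
-- vanishing crossing parities add up to a relation
-- 1 = α a a′ b + α a a′ b′ + γ a b b′ + γ a′ b b′.  Summed over the three pairs
-- b , b′, the α's cancel, and σ a = Σ γ a b b′ takes different values in F₂ at any
-- two of the three vertices a.

open import Defs
open import Data.Bool.Base using (Bool; true; false; not; _xor_)
open import Data.Bool.Properties using (xor-comm)
open import Data.Bool.Solver using (module xor-∧-Solver)
open import Data.Empty using (⊥)
open import Data.Fin.Base as Fin
  using (Fin; zero; suc; toℕ; fromℕ<; _↑ˡ_; _↑ʳ_; splitAt; inject≤; combine;
         funToFin; finToFun)
import Data.Fin.Properties as Fin
open import Data.Fin.Subset using (∣_∣; ⁅_⁆; _∪_; _∈_)
open import Data.Fin.Subset.Properties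
  using (x∈⁅x⁆; x∈⁅y⁆⇒x≡y; ∣⁅x⁆∣≡1; p⊆p∪q; q⊆p∪q; x∈p∪q⁻; ∪-identityˡ; ∪-identityʳ)
open import Data.Nat.Base using (ℕ) renaming (_<_ to _<ℕ_)
import Data.Nat.Base as ℕ
import Data.Nat.Properties as ℕ
open import Data.Nat.DivMod using (m<n⇒m%n≡m)
open import Data.Product using (∃-syntax; _×_; _,_; proj₁; proj₂)
open import Data.Rational.Base as ℚ using (ℚ; 0ℚ; 1ℚ)
import Data.Rational.Properties as ℚ
open import Data.Rational.Solver using (module +-*-Solver)
open import Data.Sum.Base using (_⊎_; inj₁; inj₂)
open import Function.Base using (_∘_)
open import Function.Bundles using (module Bijection)
open import Function.Definitions using (Injective)
open import Relation.Binary.Definitions using (tri<; tri≈; tri>)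
open import Relation.Binary.PropositionalEquality
  using (_≡_; _≢_; refl; sym; trans; cong; cong₂; subst; module ≡-Reasoning)
open import Relation.Nullary.Decidable.Core using (yes; no)
open import Relation.Nullary.Reflects using (Reflects; ofʸ; ofⁿ)
open import Relation.Nullary.Negation.Core using (¬_; contradiction)

-- Cauchy reals

Eventually : (ℕ → Set) → Set
Eventually P = ∃[ N ] (∀ n → N ℕ.≤ n → P n)

always : ∀ {P : ℕ → Set} → (∀ n → P n) → Eventually P
always p = 0 , λ n _ → p n

eventually-map₂ : ∀ {P Q R : ℕ → Set} → (∀ {n} → P n → Q n → R n) →
                  Eventually P → Eventually Q → Eventually R
eventually-map₂ f (M , p) (N , q) = M ℕ.⊔ N , λ n n≥ →
  f (p n (ℕ.m⊔n≤o⇒m≤o M N n≥)) (q n (ℕ.m⊔n≤o⇒n≤o M N n≥))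

eventually-map : ∀ {P Q : ℕ → Set} → (∀ {n} → P n → Q n) →
                 Eventually P → Eventually Q
eventually-map f (N , p) = N , λ n n≥ → f (p n n≥)

0<*0< : ∀ {p q} → 0ℚ ℚ.< p → 0ℚ ℚ.< q → 0ℚ ℚ.< p ℚ.* q
0<*0< {p} {q} 0<p 0<q =
  ℚ.positive⁻¹ _ {{ℚ.pos*pos⇒pos p {{ℚ.positive 0<p}} q {{ℚ.positive 0<q}}}}

*-mono-≤-pos : ∀ {p q r s} → 0ℚ ℚ.< p → 0ℚ ℚ.< r → p ℚ.≤ q → r ℚ.≤ s →
               p ℚ.* r ℚ.≤ q ℚ.* s
*-mono-≤-pos {p} {q} {r} {s} 0<p 0<r p≤q r≤s = ℚ.≤-trans
  (ℚ.*-monoʳ-≤-nonNeg r {{ℚ.nonNegative (ℚ.<⇒≤ 0<r)}} p≤q)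
  (ℚ.*-monoˡ-≤-nonNeg q {{ℚ.nonNegative (ℚ.≤-trans (ℚ.<⇒≤ 0<p) p≤q)}} r≤s)

reciprocal : ∀ {p} → 0ℚ ℚ.< p → ∃[ q ] (0ℚ ℚ.< q × p ℚ.* q ≡ 1ℚ)
reciprocal {p} 0<p = (ℚ.1/ p) {{nz}} ,
  ℚ.positive⁻¹ _ {{ℚ.1/pos⇒pos p {{ℚ.positive 0<p}}}} ,
  ℚ.*-inverseʳ p {{nz}}
  where
  nz : ℚ.NonZero p
  nz = ℚ.pos⇒nonZero p {{ℚ.positive 0<p}}

bounded-away : ∀ {x} → 0ℝ < x →
               ∃[ ε ] (0ℚ ℚ.< ε × Eventually (λ n → ε ℚ.≤ seq x n))
bounded-away {x} (ε , 0<ε , ev) = ε , 0<ε ,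
  eventually-map (λ {n} → subst (ℚ._≤ seq x n) (ℚ.+-identityˡ ε)) ev

bounded-away⁻¹ : ∀ x ε → 0ℚ ℚ.< ε → Eventually (λ n → ε ℚ.≤ seq x n) → 0ℝ < x
bounded-away⁻¹ x ε 0<ε ev = ε , 0<ε ,
  eventually-map (λ {n} → subst (ℚ._≤ seq x n) (sym (ℚ.+-identityˡ ε))) ev

0<⇒eventually-0< : ∀ {x} → 0ℝ < x → Eventually (λ n → 0ℚ ℚ.< seq x n)
0<⇒eventually-0< {x} 0<x with bounded-away {x} 0<x
... | ε , 0<ε , ev = eventually-map (ℚ.<-≤-trans 0<ε) ev

eventually-0≤⇒0≤ : ∀ {x} → Eventually (λ n → 0ℚ ℚ.≤ seq x n) → 0ℝ ≤ x
eventually-0≤⇒0≤ {x} (M , 0≤x) (ε , 0<ε , N , x+ε≤0) =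
  ℚ.<-irrefl refl (ℚ.<-≤-trans 0<x+ε (x+ε≤0 (M ℕ.⊔ N) (ℕ.m≤n⊔m M N)))
  where
  0<x+ε : 0ℚ ℚ.< seq x (M ℕ.⊔ N) ℚ.+ ε
  0<x+ε = ℚ.+-mono-≤-< (0≤x (M ℕ.⊔ N) (ℕ.m≤m⊔n M N)) 0<ε

eventually-≤1⇒≤1 : ∀ {x} → Eventually (λ n → seq x n ℚ.≤ 1ℚ) → x ≤ 1ℝ
eventually-≤1⇒≤1 {x} (M , x≤1) (ε , 0<ε , N , 1+ε≤x) =
  ℚ.<-irrefl refl (ℚ.<-≤-trans 1<1+ε
    (ℚ.≤-trans (1+ε≤x K (ℕ.m≤n⊔m M N)) (x≤1 K (ℕ.m≤m⊔n M N))))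
  where
  K : ℕ
  K = M ℕ.⊔ N
  1<1+ε : 1ℚ ℚ.< 1ℚ ℚ.+ ε
  1<1+ε = ℚ.+-monoʳ-< 1ℚ 0<ε

eventually-≡⇒≈ : ∀ {x y} → Eventually (λ n → seq x n ≡ seq y n) → x ≈ y
eventually-≡⇒≈ {x} {y} (N , x≡y) ε 0<ε = N , λ n n≥ →
  subst (ℚ._< ε) (sym (cong ℚ.∣_∣ (trans (cong (ℚ._- seq y n) (x≡y n n≥))
    (ℚ.+-inverseʳ (seq y n))))) 0<ε

+-positive : ∀ {x y} → 0ℝ < x → 0ℝ < y → 0ℝ < x + y
+-positive {x} {y} 0<x 0<y with bounded-away {x} 0<x | bounded-away {y} 0<y
... | δ , 0<δ , x≥δ | ε , 0<ε , y≥ε = bounded-away⁻¹ (x + y) (δ ℚ.+ ε)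
  (ℚ.+-mono-< 0<δ 0<ε) (eventually-map₂ ℚ.+-mono-≤ x≥δ y≥ε)

*-positive : ∀ {x y} → 0ℝ < x → 0ℝ < y → 0ℝ < x * y
*-positive {x} {y} 0<x 0<y with bounded-away {x} 0<x | bounded-away {y} 0<y
... | δ , 0<δ , x≥δ | ε , 0<ε , y≥ε = bounded-away⁻¹ (x * y) (δ ℚ.* ε)
  (0<*0< 0<δ 0<ε) (eventually-map₂ (*-mono-≤-pos 0<δ 0<ε) x≥δ y≥ε)

positive-resp-≡ : ∀ x y → Eventually (λ n → seq x n ≡ seq y n) → 0ℝ < x → 0ℝ < y
positive-resp-≡ x y x≡y (ε , 0<ε , ev) = ε , 0<ε ,
  eventually-map₂ (subst (0ℚ ℚ.+ ε ℚ.≤_)) x≡y ev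

-- The reciprocal is Lipschitz on the numbers above a positive `ε`, so it preserves Cauchy
-- sequences, and an upper bound on `x` keeps the reciprocal away from 0. The equation holds term by
-- term from some index on, so that later identities between reals reduce to identities in ℚ.
inverse : ∀ {x} → 0ℝ < x → ∃[ y ] (0ℝ < y ×
          Eventually (λ n → seq x n ℚ.* seq y n ≡ 1ℚ))
inverse {x} 0<x with bounded-away {x} 0<x
... | ε , 0<ε , N , x≥ε = mkℝ y y-cauchy , 0<y , N , xy≡1
  where
  open ℚ.≤-Reasoning
  open +-*-Solver

  -- The truncation makes every term invertible and changes only finitely many.
  a : ℕ → ℚ
  a n = seq x n ℚ.⊔ ε

  ε≤a : ∀ n → ε ℚ.≤ a n
  ε≤a n = ℚ.p≤q⊔p (seq x n) ε

  0<a : ∀ n → 0ℚ ℚ.< a n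
  0<a n = ℚ.<-≤-trans 0<ε (ε≤a n)

  a≡x : ∀ n → N ℕ.≤ n → a n ≡ seq x n
  a≡x n n≥ = ℚ.p≥q⇒p⊔q≡p (x≥ε n n≥)

  y : ℕ → ℚ
  y n = proj₁ (reciprocal (0<a n))

  0<yₙ : ∀ n → 0ℚ ℚ.< y n
  0<yₙ n = proj₁ (proj₂ (reciprocal (0<a n)))

  ay≡1 : ∀ n → a n ℚ.* y n ≡ 1ℚ
  ay≡1 n = proj₂ (proj₂ (reciprocal (0<a n)))

  xy≡1 : ∀ n → N ℕ.≤ n → seq x n ℚ.* y n ≡ 1ℚ
  xy≡1 n n≥ = trans (cong (ℚ._* y n) (sym (a≡x n n≥))) (ay≡1 n)

  K : ℚ
  K = proj₁ (reciprocal 0<ε)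

  0<K : 0ℚ ℚ.< K
  0<K = proj₁ (proj₂ (reciprocal 0<ε))

  εK≡1 : ε ℚ.* K ≡ 1ℚ
  εK≡1 = proj₂ (proj₂ (reciprocal 0<ε))

  y≤K : ∀ n → y n ℚ.≤ K
  y≤K n = begin
    y n                    ≡⟨ ℚ.*-identityˡ (y n) ⟨
    1ℚ ℚ.* y n             ≡⟨ cong (ℚ._* y n) εK≡1 ⟨
    ε ℚ.* K ℚ.* y n        ≤⟨ *-mono-≤-pos (0<*0< 0<ε 0<K) (0<yₙ n)
                               (*-mono-≤-pos 0<ε 0<K (ε≤a n) ℚ.≤-refl) ℚ.≤-refl ⟩
    a n ℚ.* K ℚ.* y n      ≡⟨ solve 3 (λ a k y → a :* k :* y := k :* (a :* y))
                               refl (a n) K (y n) ⟩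
    K ℚ.* (a n ℚ.* y n)    ≡⟨ cong (K ℚ.*_) (ay≡1 n) ⟩
    K ℚ.* 1ℚ               ≡⟨ ℚ.*-identityʳ K ⟩
    K ∎

  y-difference : ∀ m n → y m ℚ.- y n ≡ y m ℚ.* y n ℚ.* (a n ℚ.- a m)
  y-difference m n = begin-equality
    y m ℚ.- y n
      ≡⟨ cong₂ ℚ._-_ (ℚ.*-identityʳ (y m)) (ℚ.*-identityʳ (y n)) ⟨
    y m ℚ.* 1ℚ ℚ.- y n ℚ.* 1ℚ
      ≡⟨ cong₂ (λ p q → y m ℚ.* p ℚ.- y n ℚ.* q) (ay≡1 n) (ay≡1 m) ⟨
    y m ℚ.* (a n ℚ.* y n) ℚ.- y n ℚ.* (a m ℚ.* y m)
      ≡⟨ solve 4 (λ a y b z → z :* (a :* y) :- y :* (b :* z) := z :* y :* (a :- b))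
           refl (a n) (y n) (a m) (y m) ⟩
    y m ℚ.* y n ℚ.* (a n ℚ.- a m) ∎

  y-cauchy : IsCauchy y
  -- The factor `y m * y n` in `y-difference` is at most `K * K`, and `ε * K` is 1, so the tolerance
  -- `ε * ε * δ` for `x` becomes `δ` for `y`.
  y-cauchy δ 0<δ with isCauchy x (ε ℚ.* ε ℚ.* δ) (0<*0< (0<*0< 0<ε 0<ε) 0<δ)
  ... | M , hM = M ℕ.⊔ N , λ m n m≥ n≥ → begin-strict
    ℚ.∣ y m ℚ.- y n ∣
      ≡⟨ cong ℚ.∣_∣ (y-difference m n) ⟩
    ℚ.∣ y m ℚ.* y n ℚ.* (a n ℚ.- a m) ∣
      ≡⟨ ℚ.∣p*q∣≡∣p∣*∣q∣ (y m ℚ.* y n) (a n ℚ.- a m) ⟩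
    ℚ.∣ y m ℚ.* y n ∣ ℚ.* ℚ.∣ a n ℚ.- a m ∣
      ≡⟨ cong₂ ℚ._*_ (ℚ.0≤p⇒∣p∣≡p (ℚ.<⇒≤ (0<*0< (0<yₙ m) (0<yₙ n))))
           (cong ℚ.∣_∣ (cong₂ ℚ._-_ (a≡x n (ℕ.m⊔n≤o⇒n≤o M N n≥))
                                    (a≡x m (ℕ.m⊔n≤o⇒n≤o M N m≥)))) ⟩
    y m ℚ.* y n ℚ.* ℚ.∣ seq x n ℚ.- seq x m ∣
      <⟨ ℚ.*-monoʳ-<-pos (y m ℚ.* y n) {{ℚ.positive (0<*0< (0<yₙ m) (0<yₙ n))}}
           (hM n m (ℕ.m⊔n≤o⇒m≤o M N n≥) (ℕ.m⊔n≤o⇒m≤o M N m≥)) ⟩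
    y m ℚ.* y n ℚ.* (ε ℚ.* ε ℚ.* δ)
      ≤⟨ *-mono-≤-pos (0<*0< (0<yₙ m) (0<yₙ n)) (0<*0< (0<*0< 0<ε 0<ε) 0<δ)
           (*-mono-≤-pos (0<yₙ m) (0<yₙ n) (y≤K m) (y≤K n)) ℚ.≤-refl ⟩
    K ℚ.* K ℚ.* (ε ℚ.* ε ℚ.* δ)
      ≡⟨ solve 3 (λ k e d → k :* k :* (e :* e :* d) := (e :* k) :* ((e :* k) :* d)) refl K ε δ ⟩
    (ε ℚ.* K) ℚ.* ((ε ℚ.* K) ℚ.* δ)
      ≡⟨ cong (λ p → p ℚ.* (p ℚ.* δ)) εK≡1 ⟩
    1ℚ ℚ.* (1ℚ ℚ.* δ)
      ≡⟨ trans (ℚ.*-identityˡ _) (ℚ.*-identityˡ δ) ⟩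
    δ ∎

  0<y : 0ℝ < mkℝ y y-cauchy
  0<y with isCauchy x 1ℚ (ℚ.positive⁻¹ 1ℚ)
  ... | M , hM = bounded-away⁻¹ (mkℝ y y-cauchy) c 0<c (P , c≤y)
    where
    P : ℕ
    P = M ℕ.⊔ N

    -- From `P` on the sequence stays within 1 of its value at `P`; hence `B` bounds it from above,
    -- and the reciprocal `c` of `B` bounds `y` from below.
    B : ℚ
    B = 1ℚ ℚ.+ seq x P

    0<B : 0ℚ ℚ.< B
    0<B = ℚ.+-mono-< (ℚ.positive⁻¹ 1ℚ) (subst (0ℚ ℚ.<_) (a≡x P (ℕ.m≤n⊔m M N)) (0<a P))

    c : ℚ
    c = proj₁ (reciprocal 0<B)

    0<c : 0ℚ ℚ.< c
    0<c = proj₁ (proj₂ (reciprocal 0<B))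

    a≤B : ∀ n → P ℕ.≤ n → a n ℚ.≤ B
    a≤B n n≥ = begin
      a n                                ≡⟨ a≡x n (ℕ.m⊔n≤o⇒n≤o M N n≥) ⟩
      seq x n                            ≡⟨ solve 2 (λ p q → p := (p :- q) :+ q)
                                              refl (seq x n) (seq x P) ⟩
      (seq x n ℚ.- seq x P) ℚ.+ seq x P  ≤⟨ ℚ.+-monoˡ-≤ (seq x P) (ℚ.≤-trans (p≤∣p∣ _) (ℚ.<⇒≤
                                              (hM n P (ℕ.m⊔n≤o⇒m≤o M N n≥) (ℕ.m≤m⊔n M N)))) ⟩
      B                                  ∎
      where
      p≤∣p∣ : ∀ p → p ℚ.≤ ℚ.∣ p ∣
      p≤∣p∣ p with ℚ.≤-total 0ℚ p
      ... | inj₁ 0≤p = ℚ.≤-reflexive (sym (ℚ.0≤p⇒∣p∣≡p 0≤p))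
      ... | inj₂ p≤0 = ℚ.≤-trans p≤0 (ℚ.0≤∣p∣ p)

    c≤y : ∀ n → P ℕ.≤ n → c ℚ.≤ y n
    c≤y n n≥ = begin
      c                   ≡⟨ ℚ.*-identityʳ c ⟨
      c ℚ.* 1ℚ            ≡⟨ cong (c ℚ.*_) (ay≡1 n) ⟨
      c ℚ.* (a n ℚ.* y n) ≤⟨ *-mono-≤-pos 0<c (0<*0< (0<a n) (0<yₙ n)) ℚ.≤-refl
                             (*-mono-≤-pos (0<a n) (0<yₙ n) (a≤B n n≥) ℚ.≤-refl) ⟩
      c ℚ.* (B ℚ.* y n)   ≡⟨ solve 3 (λ c b y → c :* (b :* y) := (b :* c) :* y) refl c B (y n) ⟩
      B ℚ.* c ℚ.* y n     ≡⟨ cong (ℚ._* y n) (proj₂ (proj₂ (reciprocal 0<B))) ⟩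
      1ℚ ℚ.* y n          ≡⟨ ℚ.*-identityˡ (y n) ⟩
      y n                 ∎

product-cancel : ∀ p q r → p ℚ.* r ≡ 1ℚ → p ℚ.* q ℚ.* r ≡ q
product-cancel p q r pr≡1 = begin
  p ℚ.* q ℚ.* r  ≡⟨ solve 3 (λ p q r → p :* q :* r := p :* r :* q) refl p q r ⟩
  p ℚ.* r ℚ.* q  ≡⟨ cong (ℚ._* q) pr≡1 ⟩
  1ℚ ℚ.* q       ≡⟨ ℚ.*-identityˡ q ⟩
  q              ∎
  where
  open ≡-Reasoning
  open +-*-Solver

-- Multiply by the reciprocal of `x`. This divides a Plücker relation by a factor already known to
-- be positive.
*-cancel-positive : ∀ {x y} → 0ℝ < x → 0ℝ < x * y → 0ℝ < y
*-cancel-positive {x} {y} 0<x 0<xy = go (inverse {x} 0<x)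
  where
  go : ∃[ z ] (0ℝ < z × Eventually (λ n → seq x n ℚ.* seq z n ≡ 1ℚ)) → 0ℝ < y
  go (z , 0<z , xz≡1) = positive-resp-≡ (x * y * z) y
    (eventually-map (λ {n} → product-cancel (seq x n) (seq y n) (seq z n)) xz≡1)
    (*-positive {x * y} {z} 0<xy 0<z)

-- Convex polygons

module _ where
  open +-*-Solver

  orient-rotate : ∀ a b c n → seq (orient a b c) n ≡ seq (orient c a b) n
  orient-rotate (ax , ay) (bx , by) (cx , cy) n =
    solve 6 (λ ax ay bx by cx cy →
      (bx :- ax) :* (cy :- ay) :- (by :- ay) :* (cx :- ax) :=
      (ax :- cx) :* (by :- cy) :- (ay :- cy) :* (bx :- cx)) refl
      (seq ax n) (seq ay n) (seq bx n) (seq by n) (seq cx n) (seq cy n)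

  -- First coordinate of the linear dependence [y z] x + [x y] z = [x z] y between three plane
  -- vectors, where brackets are 2 by 2 determinants; `cramer₂` is the second coordinate.
  cramer₁ : ∀ x₁ x₂ y₁ y₂ z₁ z₂ →
    (y₁ ℚ.* z₂ ℚ.- y₂ ℚ.* z₁) ℚ.* x₁ ℚ.+ (x₁ ℚ.* y₂ ℚ.- x₂ ℚ.* y₁) ℚ.* z₁ ≡
    (x₁ ℚ.* z₂ ℚ.- x₂ ℚ.* z₁) ℚ.* y₁
  cramer₁ = solve 6 (λ x₁ x₂ y₁ y₂ z₁ z₂ →
    (y₁ :* z₂ :- y₂ :* z₁) :* x₁ :+ (x₁ :* y₂ :- x₂ :* y₁) :* z₁ :=
    (x₁ :* z₂ :- x₂ :* z₁) :* y₁) refl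

  cramer₂ : ∀ x₁ x₂ y₁ y₂ z₁ z₂ →
    (y₁ ℚ.* z₂ ℚ.- y₂ ℚ.* z₁) ℚ.* x₂ ℚ.+ (x₁ ℚ.* y₂ ℚ.- x₂ ℚ.* y₁) ℚ.* z₂ ≡
    (x₁ ℚ.* z₂ ℚ.- x₂ ℚ.* z₁) ℚ.* y₂
  cramer₂ = solve 6 (λ x₁ x₂ y₁ y₂ z₁ z₂ →
    (y₁ :* z₂ :- y₂ :* z₁) :* x₂ :+ (x₁ :* y₂ :- x₂ :* y₁) :* z₂ :=
    (x₁ :* z₂ :- x₂ :* z₁) :* y₂) refl

  -- Take the determinant of `u` with both sides of the dependence in `cramer₁` and `cramer₂`.
  plücker : ∀ u₁ u₂ x₁ x₂ y₁ y₂ z₁ z₂ →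
    (u₁ ℚ.* x₂ ℚ.- u₂ ℚ.* x₁) ℚ.* (y₁ ℚ.* z₂ ℚ.- y₂ ℚ.* z₁) ℚ.+
    (u₁ ℚ.* z₂ ℚ.- u₂ ℚ.* z₁) ℚ.* (x₁ ℚ.* y₂ ℚ.- x₂ ℚ.* y₁) ≡
    (u₁ ℚ.* y₂ ℚ.- u₂ ℚ.* y₁) ℚ.* (x₁ ℚ.* z₂ ℚ.- x₂ ℚ.* z₁)
  plücker u₁ u₂ x₁ x₂ y₁ y₂ z₁ z₂ = begin
    (u₁ ℚ.* x₂ ℚ.- u₂ ℚ.* x₁) ℚ.* yz ℚ.+ (u₁ ℚ.* z₂ ℚ.- u₂ ℚ.* z₁) ℚ.* xy
      ≡⟨ solve 8 (λ u₁ u₂ x₁ x₂ z₁ z₂ yz xy →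
           (u₁ :* x₂ :- u₂ :* x₁) :* yz :+ (u₁ :* z₂ :- u₂ :* z₁) :* xy :=
           u₁ :* (yz :* x₂ :+ xy :* z₂) :- u₂ :* (yz :* x₁ :+ xy :* z₁))
           refl u₁ u₂ x₁ x₂ z₁ z₂ yz xy ⟩
    u₁ ℚ.* (yz ℚ.* x₂ ℚ.+ xy ℚ.* z₂) ℚ.- u₂ ℚ.* (yz ℚ.* x₁ ℚ.+ xy ℚ.* z₁)
      ≡⟨ cong₂ (λ p q → u₁ ℚ.* p ℚ.- u₂ ℚ.* q)
           (cramer₂ x₁ x₂ y₁ y₂ z₁ z₂) (cramer₁ x₁ x₂ y₁ y₂ z₁ z₂) ⟩
    u₁ ℚ.* (xz ℚ.* y₂) ℚ.- u₂ ℚ.* (xz ℚ.* y₁)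
      ≡⟨ solve 5 (λ u₁ u₂ y₁ y₂ xz →
           u₁ :* (xz :* y₂) :- u₂ :* (xz :* y₁) := (u₁ :* y₂ :- u₂ :* y₁) :* xz)
           refl u₁ u₂ y₁ y₂ xz ⟩
    (u₁ ℚ.* y₂ ℚ.- u₂ ℚ.* y₁) ℚ.* xz ∎
    where
    open ≡-Reasoning
    yz xy xz : ℚ
    yz = y₁ ℚ.* z₂ ℚ.- y₂ ℚ.* z₁
    xy = x₁ ℚ.* y₂ ℚ.- x₂ ℚ.* y₁
    xz = x₁ ℚ.* z₂ ℚ.- x₂ ℚ.* z₁

  -- Both sides are twice the signed area of the quadrilateral a b c d, cut along the diagonal b d
  -- on the left and along a c on the right.
  quadrilateral-area : ∀ a b c d n →
    seq (orient a b d + orient b c d) n ≡ seq (orient a b c + orient a c d) n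
  quadrilateral-area (ax , ay) (bx , by) (cx , cy) (dx , dy) n =
    solve 8 (λ ax ay bx by cx cy dx dy →
      ((bx :- ax) :* (dy :- ay) :- (by :- ay) :* (dx :- ax)) :+
      ((cx :- bx) :* (dy :- by) :- (cy :- by) :* (dx :- bx)) :=
      ((bx :- ax) :* (cy :- ay) :- (by :- ay) :* (cx :- ax)) :+
      ((cx :- ax) :* (dy :- ay) :- (cy :- ay) :* (dx :- ax))) refl
      (seq ax n) (seq ay n) (seq bx n) (seq by n)
      (seq cx n) (seq cy n) (seq dx n) (seq dy n)

  -- With X = [abd], Y = [abc], Z = [acd] and E = 1 / (Y + Z), the point a + X E (c - a)
  -- of one diagonal is the point b + Y E (d - b) of the other, coordinate by coordinate.
  same-point : ∀ X Y Z E a b c d → (Y ℚ.+ Z) ℚ.* E ≡ 1ℚ →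
    Z ℚ.* (b ℚ.- a) ℚ.+ Y ℚ.* (d ℚ.- a) ≡ X ℚ.* (c ℚ.- a) →
    (1ℚ ℚ.- X ℚ.* E) ℚ.* a ℚ.+ X ℚ.* E ℚ.* c ≡
    (1ℚ ℚ.- Y ℚ.* E) ℚ.* b ℚ.+ Y ℚ.* E ℚ.* d
  same-point X Y Z E a b c d Y+Z·E≡1 eq = begin
    (1ℚ ℚ.- X ℚ.* E) ℚ.* a ℚ.+ X ℚ.* E ℚ.* c
      ≡⟨ solve 4 (λ XE a c o → (o :- XE) :* a :+ XE :* c := o :* a :+ XE :* (c :- a))
           refl (X ℚ.* E) a c 1ℚ ⟩
    1ℚ ℚ.* a ℚ.+ X ℚ.* E ℚ.* (c ℚ.- a)
      ≡⟨ cong (1ℚ ℚ.* a ℚ.+_)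
           (solve 3 (λ X E f → X :* E :* f := X :* f :* E) refl X E (c ℚ.- a)) ⟩
    1ℚ ℚ.* a ℚ.+ X ℚ.* (c ℚ.- a) ℚ.* E
      ≡⟨ cong (λ p → 1ℚ ℚ.* a ℚ.+ p ℚ.* E) (sym eq) ⟩
    1ℚ ℚ.* a ℚ.+ (Z ℚ.* (b ℚ.- a) ℚ.+ Y ℚ.* (d ℚ.- a)) ℚ.* E
      -- Replacing the remaining 1 by `(Y + Z) * E` turns the next step into a polynomial identity.
      ≡⟨ cong (λ p → p ℚ.* a ℚ.+ (Z ℚ.* (b ℚ.- a) ℚ.+ Y ℚ.* (d ℚ.- a)) ℚ.* E) (sym Y+Z·E≡1) ⟩
    (Y ℚ.+ Z) ℚ.* E ℚ.* a ℚ.+ (Z ℚ.* (b ℚ.- a) ℚ.+ Y ℚ.* (d ℚ.- a)) ℚ.* E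
      ≡⟨ solve 6 (λ Y Z E a b d →
           (Y :+ Z) :* E :* a :+ (Z :* (b :- a) :+ Y :* (d :- a)) :* E :=
           ((Y :+ Z) :* E :- Y :* E) :* b :+ Y :* E :* d) refl Y Z E a b d ⟩
    ((Y ℚ.+ Z) ℚ.* E ℚ.- Y ℚ.* E) ℚ.* b ℚ.+ Y ℚ.* E ℚ.* d
      ≡⟨ cong (λ p → (p ℚ.- Y ℚ.* E) ℚ.* b ℚ.+ Y ℚ.* E ℚ.* d) Y+Z·E≡1 ⟩
    (1ℚ ℚ.- Y ℚ.* E) ℚ.* b ℚ.+ Y ℚ.* E ℚ.* d ∎
    where
    open ≡-Reasoning

orient-plücker : ∀ a u x y z n →
  seq (orient a u x * orient a y z + orient a u z * orient a x y) n ≡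
  seq (orient a u y * orient a x z) n
orient-plücker (ax , ay) (ux , uy) (xx , xy) (yx , yy) (zx , zy) n =
  plücker (seq (ux - ax) n) (seq (uy - ay) n) (seq (xx - ax) n) (seq (xy - ay) n)
          (seq (yx - ax) n) (seq (yy - ay) n) (seq (zx - ax) n) (seq (zy - ay) n)

module _ {n} {p : Fin n → Point} (convex : StrictlyConvexPolygon p) where

  -- Since `i + 1` is the index of `j`, it is below `n`, so `cyclicSuc` does not wrap around and the
  -- pair is a side of the polygon.
  orient-side : ∀ i j k → toℕ j ≡ ℕ.suc (toℕ i) → k ≢ i → k ≢ j →
                0ℝ < orient (p i) (p j) (p k)
  orient-side i j k j≡1+i k≢i k≢j =
    subst (λ l → 0ℝ < orient (p i) (p l) (p k)) next≡j
      (convex i k k≢i (λ k≡next → k≢j (trans k≡next next≡j)))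
    where
    toℕ-cyclicSuc : ∀ {n} (i j : Fin n) → toℕ j ≡ ℕ.suc (toℕ i) →
                    toℕ (cyclicSuc i) ≡ toℕ j
    toℕ-cyclicSuc {ℕ.suc n} i j j≡1+i = trans (Fin.toℕ-fromℕ< _)
      (trans (m<n⇒m%n≡m (subst (ℕ._< ℕ.suc n) j≡1+i (Fin.toℕ<n j))) (sym j≡1+i))

    next≡j : cyclicSuc i ≡ j
    next≡j = Fin.toℕ-injective (toℕ-cyclicSuc i j j≡1+i)

  orient-side′ : ∀ i j k → toℕ k ≡ ℕ.suc (toℕ j) → i ≢ j → i ≢ k →
                 0ℝ < orient (p i) (p j) (p k)
  orient-side′ i j k k≡1+j i≢j i≢k =
    positive-resp-≡ (orient (p j) (p k) (p i)) (orient (p i) (p j) (p k))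
      (always (orient-rotate (p j) (p k) (p i))) (orient-side j k i k≡1+j i≢j i≢k)

  private
    >⇒≢ : ∀ {i j : Fin n} → toℕ i ℕ.< toℕ j → j ≢ i
    >⇒≢ i<j j≡i = Fin.<⇒≢ i<j (sym j≡i)

  -- Seen from p i, all vertices lie to the left of the side to p (i + 1), so by
  -- the Plücker relation "left of" is transitive on them.
  orient-ascending : ∀ {i j} → toℕ i ℕ.< toℕ j → ∀ d k → toℕ k ≡ ℕ.suc d ℕ.+ toℕ j →
                     0ℝ < orient (p i) (p j) (p k)
  orient-ascending {i} {j} i<j ℕ.zero k k≡ = orient-side′ i j k k≡ (Fin.<⇒≢ i<j)
    (Fin.<⇒≢ (ℕ.<-trans i<j (ℕ.≤-reflexive (sym k≡))))
  orient-ascending {i} {j} i<j (ℕ.suc d) k k≡ with ℕ.suc (toℕ i) ℕ.≟ toℕ j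
  ... | yes 1+i≡j = orient-side i j k (sym 1+i≡j) (>⇒≢ (ℕ.<-trans i<j j<k)) (>⇒≢ j<k)
    where
    j<k : toℕ j ℕ.< toℕ k
    j<k = ℕ.≤-trans (ℕ.s≤s (ℕ.m≤n+m (toℕ j) (ℕ.suc d))) (ℕ.≤-reflexive (sym k≡))
  -- With u = i + 1 and y = k - 1 the relation reads [i u j] [i y k] + [i u k] [i j y] = [i u y]
  -- [i j k]. Here [i j y] is positive by induction, and each other factor except [i j k] involves a
  -- side, i u or y k.
  ... | no 1+i≢j = *-cancel-positive {orient (p i) (p u) (p y)} {orient (p i) (p j) (p k)}
    (orient-side i u y toℕ-u (>⇒≢ i<y) (>⇒≢ (ℕ.<-trans u<j j<y)))
    (positive-resp-≡
      (orient (p i) (p u) (p j) * orient (p i) (p y) (p k) +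
       orient (p i) (p u) (p k) * orient (p i) (p j) (p y))
      (orient (p i) (p u) (p y) * orient (p i) (p j) (p k))
      (always (orient-plücker (p i) (p u) (p j) (p y) (p k)))
      (+-positive {orient (p i) (p u) (p j) * orient (p i) (p y) (p k)}
                  {orient (p i) (p u) (p k) * orient (p i) (p j) (p y)}
        (*-positive {orient (p i) (p u) (p j)} {orient (p i) (p y) (p k)}
          (orient-side i u j toℕ-u (>⇒≢ i<j) (>⇒≢ u<j))
          (orient-side′ i y k (trans k≡ (cong ℕ.suc (sym toℕ-y))) (Fin.<⇒≢ i<y)
            (Fin.<⇒≢ (ℕ.<-trans i<y y<k))))
        (*-positive {orient (p i) (p u) (p k)} {orient (p i) (p j) (p y)}
          (orient-side i u k toℕ-u (>⇒≢ (ℕ.<-trans i<y y<k))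
            (>⇒≢ (ℕ.<-trans u<j (ℕ.<-trans j<y y<k))))
          (orient-ascending i<j d y toℕ-y))))
    where
    1+i<j : ℕ.suc (toℕ i) ℕ.< toℕ j
    1+i<j = ℕ.≤∧≢⇒< i<j 1+i≢j

    u : Fin n
    u = fromℕ< (ℕ.<-trans 1+i<j (Fin.toℕ<n j))

    toℕ-u : toℕ u ≡ ℕ.suc (toℕ i)
    toℕ-u = Fin.toℕ-fromℕ< _

    k-1<n : ℕ.suc d ℕ.+ toℕ j ℕ.< n
    k-1<n = ℕ.≤-trans (ℕ.≤-reflexive (sym k≡)) (ℕ.<⇒≤ (Fin.toℕ<n k))

    y : Fin n
    y = fromℕ< k-1<n

    toℕ-y : toℕ y ≡ ℕ.suc d ℕ.+ toℕ j
    toℕ-y = Fin.toℕ-fromℕ< k-1<n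

    u<j : toℕ u ℕ.< toℕ j
    u<j = subst (ℕ._< toℕ j) (sym toℕ-u) 1+i<j

    j<y : toℕ j ℕ.< toℕ y
    j<y = ℕ.≤-trans (ℕ.s≤s (ℕ.m≤n+m (toℕ j) d)) (ℕ.≤-reflexive (sym toℕ-y))

    i<y : toℕ i ℕ.< toℕ y
    i<y = ℕ.<-trans i<j j<y

    y<k : toℕ y ℕ.< toℕ k
    y<k = ℕ.≤-reflexive (trans (cong ℕ.suc toℕ-y) (sym k≡))

  orient-positive : ∀ {i j k} → toℕ i ℕ.< toℕ j → toℕ j ℕ.< toℕ k →
                    0ℝ < orient (p i) (p j) (p k)
  orient-positive {i} {j} {k} i<j j<k = orient-ascending i<j (toℕ k ℕ.∸ ℕ.suc (toℕ j)) k
    (trans (sym (ℕ.m∸n+n≡m j<k)) (ℕ.+-suc _ (toℕ j)))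

-- Diagonals of a convex quadrilateral

share≤1 : ∀ p q e → p ℚ.* e ℚ.+ q ℚ.* e ≡ 1ℚ → 0ℚ ℚ.< q ℚ.* e → p ℚ.* e ℚ.≤ 1ℚ
share≤1 p q e pe+qe≡1 0<qe = begin
  p ℚ.* e              ≡⟨ ℚ.+-identityʳ (p ℚ.* e) ⟨
  p ℚ.* e ℚ.+ 0ℚ       ≤⟨ ℚ.+-monoʳ-≤ (p ℚ.* e) (ℚ.<⇒≤ 0<qe) ⟩
  p ℚ.* e ℚ.+ q ℚ.* e  ≡⟨ pe+qe≡1 ⟩
  1ℚ                   ∎
  where open ℚ.≤-Reasoning

-- The intersection point divides a c in the ratio [a b d] : [b c d] and b d in the ratio [a b c] :
-- [a c d]. By `quadrilateral-area` the two pairs of weights have the same sum, so one reciprocal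
-- `E` normalises both, and positivity of the weights puts both parameters between 0 and 1.
diagonals-meet : ∀ {a b c d} →
  0ℝ < orient a b c → 0ℝ < orient a b d → 0ℝ < orient a c d → 0ℝ < orient b c d →
  ∃[ q ] (q ∈[ a , c ] × q ∈[ b , d ])
diagonals-meet {a@(ax , ay)} {b@(bx , by)} {c@(cx , cy)} {d@(dx , dy)} 0<Y 0<X 0<Z 0<W =
  meet (inverse {Y + Z} (+-positive {Y} {Z} 0<Y 0<Z))
  where
  X Y Z W : ℝ
  X = orient a b d
  Y = orient a b c
  Z = orient a c d
  W = orient b c d

  nonNegative-product : ∀ {x y} → 0ℝ < x → 0ℝ < y → 0ℝ ≤ x * y
  nonNegative-product {x} {y} 0<x 0<y = eventually-0≤⇒0≤ {x * y}
    (eventually-map ℚ.<⇒≤ (0<⇒eventually-0< {x * y} (*-positive {x} {y} 0<x 0<y)))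

  meet : ∃[ E ] (0ℝ < E × Eventually (λ n → seq (Y + Z) n ℚ.* seq E n ≡ 1ℚ)) →
         ∃[ q ] (q ∈[ a , c ] × q ∈[ b , d ])
  meet (E , 0<E , DE≡1) =
    (qx , qy)
    , (r , 0≤r , r≤1 , eventually-≡⇒≈ {qx} {qx} (always λ _ → refl)
                     , eventually-≡⇒≈ {qy} {qy} (always λ _ → refl))
    , (s , 0≤s , s≤1
      , eventually-≡⇒≈ {qx} {(1ℝ - s) * bx + s * dx} (eventually-map (λ {n} DE≡1 →
          same-point (seq X n) (seq Y n) (seq Z n) (seq E n)
            (seq ax n) (seq bx n) (seq cx n) (seq dx n) DE≡1
            (cramer₁ (seq (bx - ax) n) (seq (by - ay) n) (seq (cx - ax) n)
                     (seq (cy - ay) n) (seq (dx - ax) n) (seq (dy - ay) n))) DE≡1)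
      , eventually-≡⇒≈ {qy} {(1ℝ - s) * by + s * dy} (eventually-map (λ {n} DE≡1 →
          same-point (seq X n) (seq Y n) (seq Z n) (seq E n)
            (seq ay n) (seq by n) (seq cy n) (seq dy n) DE≡1
            (cramer₂ (seq (bx - ax) n) (seq (by - ay) n) (seq (cx - ax) n)
                     (seq (cy - ay) n) (seq (dx - ax) n) (seq (dy - ay) n))) DE≡1))
    where
    r s qx qy : ℝ
    r = X * E
    s = Y * E
    qx = (1ℝ - r) * ax + r * cx
    qy = (1ℝ - r) * ay + r * cy

    0≤r : 0ℝ ≤ r
    0≤r = nonNegative-product {X} {E} 0<X 0<E

    0≤s : 0ℝ ≤ s
    0≤s = nonNegative-product {Y} {E} 0<Y 0<E

    r≤1 : r ≤ 1ℝ
    r≤1 = eventually-≤1⇒≤1 {r} (eventually-map₂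
      (λ {n} DE≡1 → share≤1 (seq X n) (seq W n) (seq E n)
        (trans (sym (ℚ.*-distribʳ-+ (seq E n) (seq X n) (seq W n)))
          (trans (cong (ℚ._* seq E n) (quadrilateral-area a b c d n)) DE≡1)))
      DE≡1 (0<⇒eventually-0< {W * E} (*-positive {W} {E} 0<W 0<E)))

    s≤1 : s ≤ 1ℝ
    s≤1 = eventually-≤1⇒≤1 {s} (eventually-map₂
      (λ {n} DE≡1 → share≤1 (seq Y n) (seq Z n) (seq E n)
        (trans (sym (ℚ.*-distribʳ-+ (seq E n) (seq Y n) (seq Z n))) DE≡1))
      DE≡1 (0<⇒eventually-0< {Z * E} (*-positive {Z} {E} 0<Z 0<E)))

-- The crossing parity of K₃₃

-- Pigeonhole on two values: `true xor (p xor q) ≡ false` is `p ≢ q` written as an equation over F₂.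
no-three-distinct : ∀ p q r → true xor (p xor q) ≡ false →
  true xor (p xor r) ≡ false → true xor (q xor r) ≡ false → ⊥
no-three-distinct true  true  _     () _  _
no-three-distinct true  false true  _  () _
no-three-distinct true  false false _  _  ()
no-three-distinct false false _     () _  _
no-three-distinct false true  false _  () _
no-three-distinct false true  true  _  _  ()

module Parity {A : Set} (lt : A → A → Bool)
              (lt-flip : ∀ {a b} → a ≢ b → lt b a ≡ not (lt a b)) where

  -- In a linear order, [a < c] xor [b < c] says whether c lies between a and b, so
  -- this says whether exactly one of c and d does: the arcs a b and c d cross.
  linked : A → A → A → A → Bool
  linked a b c d = (lt a c xor lt a d) xor (lt b c xor lt b d)

  module K₃₃ (x y : Fin 3 → A) (m : Fin 3 → Fin 3 → A)
    (y≢y : ∀ {b b′} → b ≢ b′ → y b ≢ y b′)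
    (y≢m : ∀ {a b b′} → y b ≢ m a b′)
    (x-unlinked : ∀ {a a′ b b′} → a ≢ a′ → b ≢ b′ →
      linked (x a) (m a b) (x a′) (m a′ b′) ≡ false)
    (y-unlinked : ∀ {a a′ b b′} → a ≢ a′ → b ≢ b′ →
      linked (y b) (m a b) (y b′) (m a′ b′) ≡ false)
    where

    open xor-∧-Solver

    -- The comparisons that survive in a four-cycle are grouped by what they depend on: `α` involves
    -- a single `b`, and `γ` a single `a`. This lets the sum over pairs of `b`'s separate.
    α : Fin 3 → Fin 3 → Fin 3 → Bool
    α a a′ b = lt (x a) (m a′ b) xor lt (m a b) (x a′)

    γ : Fin 3 → Fin 3 → Fin 3 → Bool
    γ a b b′ = lt (y b) (m a b′) xor lt (y b′) (m a b)

    -- In the sum of the four crossing parities, the comparison of `x a` with `x a′` and those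
    -- between two `m`'s occur twice and cancel. Three comparisons are reversed to match the others:
    -- that of `y b′` with `y b`, and two of an `m` with a `y`. This odd number of reversals is the
    -- constant 1.
    four-cycle : ∀ {a a′ b b′} → a ≢ a′ → b ≢ b′ →
      true xor ((α a a′ b xor α a a′ b′) xor (γ a b b′ xor γ a′ b b′)) ≡ false
    four-cycle {a} {a′} {b} {b′} a≢a′ b≢b′
      with x-unlinked a≢a′ b≢b′ | x-unlinked a≢a′ (λ e → b≢b′ (sym e))
         | y-unlinked a≢a′ b≢b′ | y-unlinked a≢a′ (λ e → b≢b′ (sym e))
    ... | x₁ | x₂ | y₁ | y₂
      rewrite lt-flip (y≢y b≢b′) | lt-flip (y≢m {a} {b′} {b}) | lt-flip (y≢m {a} {b} {b′}) =
      trans (sym (solve 12 (λ xx xm₁ mx₁ mm₁ xm₂ mx₂ mm₂ yy ym₁ ym₂ c₁ c₂ →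
          (((xx :+ xm₁) :+ (mx₁ :+ mm₁)) :+ ((xx :+ xm₂) :+ (mx₂ :+ mm₂))) :+
          (((yy :+ ym₁) :+ ((con true :+ c₁) :+ mm₁)) :+
           (((con true :+ yy) :+ ym₂) :+ ((con true :+ c₂) :+ mm₂)))
          := con true :+ (((xm₂ :+ mx₁) :+ (xm₁ :+ mx₂)) :+ ((c₂ :+ c₁) :+ (ym₁ :+ ym₂))))
        refl (lt (x a) (x a′)) (lt (x a) (m a′ b′)) (lt (m a b) (x a′)) (lt (m a b) (m a′ b′))
             (lt (x a) (m a′ b)) (lt (m a b′) (x a′)) (lt (m a b′) (m a′ b))
             (lt (y b) (y b′)) (lt (y b) (m a′ b′)) (lt (y b′) (m a′ b))
             (lt (y b′) (m a b)) (lt (y b) (m a b′))))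
        (cong₂ _xor_ (cong₂ _xor_ x₁ x₂) (cong₂ _xor_ y₁ y₂))

    σ : Fin 3 → Bool
    σ a = (γ a zero (suc zero) xor γ a zero (suc (suc zero))) xor
          γ a (suc zero) (suc (suc zero))

    -- Three vertices b form three pairs. Each of them lies in two pairs, so its `α` cancels, while
    -- the constant 1 is added three times and survives.
    σ-differ : ∀ {a a′} → a ≢ a′ → true xor (σ a xor σ a′) ≡ false
    σ-differ {a} {a′} a≢a′ = trans
      (sym (solve 9 (λ α₀ α₁ α₂ γ₀₁ γ₀₂ γ₁₂ γ₀₁′ γ₀₂′ γ₁₂′ →
          ((con true :+ ((α₀ :+ α₁) :+ (γ₀₁ :+ γ₀₁′))) :+
           (con true :+ ((α₀ :+ α₂) :+ (γ₀₂ :+ γ₀₂′)))) :+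
          (con true :+ ((α₁ :+ α₂) :+ (γ₁₂ :+ γ₁₂′)))
          := con true :+ (((γ₀₁ :+ γ₀₂) :+ γ₁₂) :+ ((γ₀₁′ :+ γ₀₂′) :+ γ₁₂′)))
        refl (α a a′ zero) (α a a′ (suc zero)) (α a a′ (suc (suc zero)))
             (γ a zero (suc zero)) (γ a zero (suc (suc zero)))
             (γ a (suc zero) (suc (suc zero)))
             (γ a′ zero (suc zero)) (γ a′ zero (suc (suc zero)))
             (γ a′ (suc zero) (suc (suc zero)))))
      (cong₂ _xor_ (cong₂ _xor_ (four-cycle a≢a′ (λ ())) (four-cycle a≢a′ (λ ())))
                   (four-cycle a≢a′ (λ ())))

    not-two-page : ⊥
    not-two-page = no-three-distinct (σ zero) (σ (suc zero)) (σ (suc (suc zero)))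
      (σ-differ (λ ())) (σ-differ (λ ())) (σ-differ (λ ()))

-- Monochromatic K₃₃

Constant-on-3 : ∀ {A : Set} {n} → (Fin n → A) → (Fin 3 → Fin n) → A → Set
Constant-on-3 f g κ = Injective _≡_ _≡_ g × ∀ i → f (g i) ≡ κ

constant-on-3 : ∀ {A : Set} {n} (f : Fin n → A) {i j k} → i ≢ j → i ≢ k → j ≢ k →
                f i ≡ f j → f i ≡ f k → ∃[ g ] Constant-on-3 f g (f i)
constant-on-3 f {i} {j} {k} i≢j i≢k j≢k fi≡fj fi≡fk = g , g-injective , g-constant
  where
  g : Fin 3 → _
  g zero             = i
  g (suc zero)       = j
  g (suc (suc zero)) = k

  g-injective : Injective _≡_ _≡_ g
  g-injective {zero}           {zero}           _ = refl
  g-injective {zero}           {suc zero}       e = contradiction e i≢j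
  g-injective {zero}           {suc (suc zero)} e = contradiction e i≢k
  g-injective {suc zero}       {zero}           e = contradiction (sym e) i≢j
  g-injective {suc zero}       {suc zero}       _ = refl
  g-injective {suc zero}       {suc (suc zero)} e = contradiction e j≢k
  g-injective {suc (suc zero)} {zero}           e = contradiction (sym e) i≢k
  g-injective {suc (suc zero)} {suc zero}       e = contradiction (sym e) j≢k
  g-injective {suc (suc zero)} {suc (suc zero)} _ = refl

  g-constant : ∀ a → f (g a) ≡ f i
  g-constant zero             = refl
  g-constant (suc zero)       = sym fi≡fj
  g-constant (suc (suc zero)) = sym fi≡fk

-- Every block of 1 + c consecutive elements repeats a colour, and two blocks
-- repeat the same colour in the same places.
pigeonhole₃ : ∀ c → ∃[ n ] ∀ (f : Fin n → Fin c) → ∃[ g ] ∃[ κ ] Constant-on-3 f g κ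
pigeonhole₃ c = ℕ.suc codes ℕ.* ℕ.suc c , find
  where
  codes : ℕ
  codes = ℕ.suc c ℕ.* ℕ.suc c ℕ.* c

  module _ (f : Fin (ℕ.suc codes ℕ.* ℕ.suc c) → Fin c) where
    block : (k : Fin (ℕ.suc codes)) →
            ∃[ i ] ∃[ j ] (i Fin.< j × f (combine k i) ≡ f (combine k j))
    block k = Fin.pigeonhole ℕ.≤-refl (λ i → f (combine k i))

    code : Fin (ℕ.suc codes) → Fin codes
    code k = let i , j , _ = block k in combine (combine i j) (f (combine k i))

    find : ∃[ g ] ∃[ κ ] Constant-on-3 f g κ
    find =
      let k , l , k<l , eq     = Fin.pigeonhole ℕ.≤-refl code
          i , j , i<j , fi≡fj  = block k
          i′ , j′ , _          = block l
          -- Two of the indices are the repeat in block `k`; the third comes from the repeat in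
          -- block `l`, whose colour agrees because the colour is part of the code.
          g , g-constant       = constant-on-3 f {combine k i} {combine k j} {combine l i′}
            (λ e → Fin.<⇒≢ i<j (Fin.combine-injectiveʳ k i k j e))
            (λ e → Fin.<⇒≢ k<l (Fin.combine-injectiveˡ k i l i′ e))
            (λ e → Fin.<⇒≢ k<l (Fin.combine-injectiveˡ k j l i′ e))
            fi≡fj (Fin.combine-injectiveʳ (combine i j) _ (combine i′ j′) _ eq)
      in g , f (combine k i) , g-constant

Forces-K₃₃ : ℕ → ℕ → ℕ → Set
Forces-K₃₃ l r c = ∀ (f : Fin l → Fin r → Fin c) →
  ∃[ g ] ∃[ h ] ∃[ κ ] (Injective _≡_ _≡_ g × Injective _≡_ _≡_ h ×
    ∀ (i j : Fin 3) → f (g i) (h j) ≡ κ)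

-- Each right vertex selects three left vertices that it joins in a single colour. Triple and colour
-- together take at most `l ^ 3 * c` values, so three right vertices make the same selection.
monochromatic-K₃₃ : ∀ c → ∃[ l ] ∃[ r ] Forces-K₃₃ l r c
monochromatic-K₃₃ c with pigeonhole₃ c
... | l , find-left with pigeonhole₃ (l ℕ.^ 3 ℕ.* c)
... | r , find-right = l , r , λ f →
  let left : ∀ b → ∃[ g ] ∃[ κ ] Constant-on-3 (λ a → f a b) g κ
      left b = find-left (λ a → f a b)
      code b = let g , κ , _ = left b in combine (funToFin g) κ
      h , κ , h-inj , h-const = find-right code
      g₀ , κ₀ , g₀-inj , _ = left (h zero)
      mono : ∀ i j → f (g₀ i) (h j) ≡ κ₀
      mono i j =
        let gⱼ , κⱼ , _ , gⱼ-const = left (h j)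
            e₁ , e₂ = Fin.combine-injective _ _ _ _ (trans (h-const zero) (sym (h-const j)))
            g₀≡gⱼ : g₀ i ≡ gⱼ i
            g₀≡gⱼ = trans (sym (Fin.finToFun-funToFin g₀ i))
              (trans (cong (λ k → finToFun k i) e₁) (Fin.finToFun-funToFin gⱼ i))
        in trans (cong (λ a → f a (h j)) g₀≡gⱼ) (trans (gⱼ-const i) (sym e₂))
  in g₀ , h , κ₀ , g₀-inj , h-inj , mono

-- Book drawings

module Spine {Γ : SimpleGraph} {s} (B : BookDrawing Γ s) where
  open SimpleGraph Γ
  open BookDrawing B

  open Bijection (proj₁ (proj₂ convex)) using (to; surjective)

  index : V → Fin (proj₁ convex)
  index v = proj₁ (surjective v)

  to-index : ∀ v → to (index v) ≡ v
  to-index v = proj₂ (surjective v) refl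

  index-injective : ∀ {u v} → index u ≡ index v → u ≡ v
  index-injective {u} {v} eq = trans (sym (to-index u)) (trans (cong to eq) (to-index v))

  infix 4 _≺_
  _≺_ : V → V → Set
  u ≺ v = index u Fin.< index v

  ≺⇒≢ : ∀ {u v} → u ≺ v → u ≢ v
  ≺⇒≢ u≺v u≡v = Fin.<⇒≢ u≺v (cong index u≡v)

  orient-≺ : ∀ {u v w} → u ≺ v → v ≺ w → 0ℝ < orient (pos u) (pos v) (pos w)
  orient-≺ {u} {v} {w} u≺v v≺w =
    subst (λ z → 0ℝ < orient (pos z) (pos v) (pos w)) (to-index u)
      (subst (λ z → 0ℝ < orient (pos (to (index u))) (pos z) (pos w)) (to-index v)
        (subst (λ z → 0ℝ < orient (pos (to (index u))) (pos (to (index v))) (pos z)) (to-index w)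
          (orient-positive {p = pos ∘ to} (proj₂ (proj₂ convex)) u≺v v≺w)))

  -- In the order u, x, v, y the four ends are successive corners of a convex quadrilateral whose
  -- diagonals are the two edges. These meet, and the edges have no common end, so they cross.
  not-alternating : ∀ {u v x y} (e : u ~ v) (f : x ~ y) → layer e ≡ layer f →
                    u ≺ x → x ≺ v → v ≺ y → ⊥
  not-alternating {u} {v} {x} {y} e f e≡f u≺x x≺v v≺y = noncross e f
    (λ { (inj₁ (u≡x , _)) → ≺⇒≢ u≺x u≡x
       ; (inj₂ (u≡y , _)) → ≺⇒≢ u≺y u≡y })
    e≡f (crossing (diagonals-meet {pos u} {pos x} {pos v} {pos y}
      (orient-≺ u≺x x≺v) (orient-≺ u≺x x≺y) (orient-≺ u≺v v≺y) (orient-≺ x≺v v≺y)))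
    where
    x≺y : x ≺ y
    x≺y = Fin.<-trans x≺v v≺y

    u≺v : u ≺ v
    u≺v = Fin.<-trans u≺x x≺v

    u≺y : u ≺ y
    u≺y = Fin.<-trans u≺v v≺y

    crossing : ∃[ q ] (q ∈[ pos u , pos v ] × q ∈[ pos x , pos y ]) →
               Crosses Γ pos u v x y
    crossing (q , q∈uv , q∈xy) = q , q∈uv , q∈xy , λ
      { (_ , inj₁ refl , inj₁ u≡x , _) → ≺⇒≢ u≺x u≡x
      ; (_ , inj₁ refl , inj₂ u≡y , _) → ≺⇒≢ u≺y u≡y
      ; (_ , inj₂ refl , inj₁ v≡x , _) → ≺⇒≢ x≺v (sym v≡x)
      ; (_ , inj₂ refl , inj₂ v≡y , _) → ≺⇒≢ v≺y v≡y }

  lt : V → V → Bool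
  lt u v = toℕ (index u) ℕ.<ᵇ toℕ (index v)

  lt-reflects-≺ : ∀ u v → Reflects (u ≺ v) (lt u v)
  lt-reflects-≺ u v = ℕ.<ᵇ-reflects-< (toℕ (index u)) (toℕ (index v))

  ⊀⇒≻ : ∀ {u v} → u ≢ v → ¬ (u ≺ v) → v ≺ u
  ⊀⇒≻ u≢v u⊀v = Fin.≤∧≢⇒< (ℕ.≮⇒≥ u⊀v) (λ eq → u≢v (index-injective (sym eq)))

  lt-flip : ∀ {u v} → u ≢ v → lt v u ≡ not (lt u v)
  lt-flip {u} {v} u≢v with lt u v | lt-reflects-≺ u v | lt v u | lt-reflects-≺ v u
  ... | true  | ofʸ u≺v | true  | ofʸ v≺u = contradiction v≺u (Fin.<-asym u≺v)
  ... | true  | _       | false | _       = refl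
  ... | false | _       | true  | _       = refl
  ... | false | ofⁿ u⊀v | false | ofⁿ v⊀u = contradiction (⊀⇒≻ u≢v u⊀v) v⊀u

  open Parity lt lt-flip public

  -- Among the outcomes of the four comparisons, the first two cases are the alternating orders, the
  -- next four violate transitivity, and in the last four the parity evaluates to `false`.
  unlinked-ascending : ∀ {u v x y} (e : u ~ v) (f : x ~ y) → layer e ≡ layer f →
    u ≢ x → v ≢ x → v ≢ y → u ≺ v → x ≺ y → linked u v x y ≡ false
  unlinked-ascending {u} {v} {x} {y} e f e≡f u≢x v≢x v≢y u≺v x≺y
    with lt u x | lt-reflects-≺ u x | lt u y | lt-reflects-≺ u y
       | lt v x | lt-reflects-≺ v x | lt v y | lt-reflects-≺ v y
  ... | true  | ofʸ u≺x | true  | _       | false | ofⁿ v⊀x | true  | ofʸ v≺y =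
        contradiction v≺y (not-alternating e f e≡f u≺x (⊀⇒≻ v≢x v⊀x))
  ... | false | ofⁿ u⊀x | true  | ofʸ u≺y | false | _       | false | ofⁿ v⊀y =
        contradiction (⊀⇒≻ v≢y v⊀y) (not-alternating f e (sym e≡f) (⊀⇒≻ u≢x u⊀x) u≺y)
  ... | true  | ofʸ u≺x | false | ofⁿ u⊀y | _     | _       | _     | _       =
        contradiction (Fin.<-trans u≺x x≺y) u⊀y
  ... | false | ofⁿ u⊀x | _     | _       | true  | ofʸ v≺x | _     | _       =
        contradiction (Fin.<-trans u≺v v≺x) u⊀x
  ... | _     | _       | false | ofⁿ u⊀y | _     | _       | true  | ofʸ v≺y =
        contradiction (Fin.<-trans u≺v v≺y) u⊀y
  ... | _     | _       | _     | _       | true  | ofʸ v≺x | false | ofⁿ v⊀y =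
        contradiction (Fin.<-trans v≺x x≺y) v⊀y
  ... | false | _       | false | _       | false | _       | false | _       = refl
  ... | false | _       | true  | _       | false | _       | true  | _       = refl
  ... | true  | _       | true  | _       | false | _       | false | _       = refl
  ... | true  | _       | true  | _       | true  | _       | true  | _       = refl

  edge-cmp : ∀ {u v} → u ~ v → u ≺ v ⊎ v ≺ u
  edge-cmp {u} {v} e with Fin.<-cmp (index u) (index v)
  ... | tri< u≺v _ _ = inj₁ u≺v
  ... | tri≈ _ eq _  = contradiction e (irrefl (index-injective eq))
  ... | tri> _ _ v≺u = inj₂ v≺u

  linked-swapˡ : ∀ u v x y → linked v u x y ≡ linked u v x y
  linked-swapˡ u v x y = xor-comm (lt v x xor lt v y) _

  linked-swapʳ : ∀ u v x y → linked u v y x ≡ linked u v x y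
  linked-swapʳ u v x y = cong₂ _xor_ (xor-comm (lt u y) _) (xor-comm (lt v y) _)

  -- `linked` is symmetric in the ends of each arc and `layer-sym` allows an edge to be reversed, so
  -- both edges may be taken ascending.
  unlinked : ∀ {u v x y} (e : u ~ v) (f : x ~ y) → layer e ≡ layer f →
    u ≢ x → u ≢ y → v ≢ x → v ≢ y → linked u v x y ≡ false
  unlinked {u} {v} {x} {y} e f e≡f u≢x u≢y v≢x v≢y with edge-cmp e | edge-cmp f
  ... | inj₁ u≺v | inj₁ x≺y = unlinked-ascending e f e≡f u≢x v≢x v≢y u≺v x≺y
  ... | inj₁ u≺v | inj₂ y≺x = trans (sym (linked-swapʳ u v x y))
    (unlinked-ascending e (symm f) (trans e≡f (layer-sym f (symm f))) u≢y v≢y v≢x u≺v y≺x)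
  ... | inj₂ v≺u | inj₁ x≺y = trans (sym (linked-swapˡ u v x y))
    (unlinked-ascending (symm e) f (trans (layer-sym (symm e) e) e≡f) v≢x u≢x u≢y v≺u x≺y)
  ... | inj₂ v≺u | inj₂ y≺x = trans (sym (linked-swapˡ u v x y)) (trans (sym (linked-swapʳ v u x y))
    (unlinked-ascending (symm e) (symm f)
      (trans (layer-sym (symm e) e) (trans e≡f (layer-sym f (symm f))))
      v≢y u≢y u≢x v≺u y≺x))

-- Subdivided complete graphs

∣⁅x⁆∪⁅y⁆∣≡2 : ∀ {n} {x y : Fin n} → x ≢ y → ∣ ⁅ x ⁆ ∪ ⁅ y ⁆ ∣ ≡ 2
∣⁅x⁆∪⁅y⁆∣≡2 {x = zero}  {zero}  x≢y = contradiction refl x≢y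
∣⁅x⁆∪⁅y⁆∣≡2 {x = zero}  {suc y} x≢y =
  cong ℕ.suc (trans (cong ∣_∣ (∪-identityˡ ⁅ y ⁆)) (∣⁅x⁆∣≡1 y))
∣⁅x⁆∪⁅y⁆∣≡2 {x = suc x} {zero}  x≢y =
  cong ℕ.suc (trans (cong ∣_∣ (∪-identityʳ ⁅ x ⁆)) (∣⁅x⁆∣≡1 x))
∣⁅x⁆∪⁅y⁆∣≡2 {x = suc x} {suc y} x≢y = ∣⁅x⁆∪⁅y⁆∣≡2 (x≢y ∘ cong suc)

module _ {k : ℕ} where
  open SimpleGraph (G k)

  single : Fin k → V
  single i = ⁅ i ⁆ , inj₁ (∣⁅x⁆∣≡1 i)

  pair : (i j : Fin k) → i ≢ j → V
  pair i j i≢j = ⁅ i ⁆ ∪ ⁅ j ⁆ , inj₂ (∣⁅x⁆∪⁅y⁆∣≡2 i≢j)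

  single-injective : ∀ {i j} → single i ≡ single j → i ≡ j
  single-injective {i} {j} eq = x∈⁅y⁆⇒x≡y j (subst (i ∈_) (cong proj₁ eq) (x∈⁅x⁆ i))

  ⁅h⁆≢⁅i⁆∪⁅j⁆ : ∀ {h i j : Fin k} → i ≢ j → ⁅ h ⁆ ≢ ⁅ i ⁆ ∪ ⁅ j ⁆
  ⁅h⁆≢⁅i⁆∪⁅j⁆ {h} i≢j eq
    with trans (sym (∣⁅x⁆∣≡1 h)) (trans (cong ∣_∣ eq) (∣⁅x⁆∪⁅y⁆∣≡2 i≢j))
  ... | ()

  single≢pair : ∀ {h i j} {i≢j : i ≢ j} → single h ≢ pair i j i≢j
  single≢pair {i≢j = i≢j} eq = ⁅h⁆≢⁅i⁆∪⁅j⁆ i≢j (cong proj₁ eq)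

  pair-overlap : ∀ {i j i′ j′ p q} → pair i j p ≡ pair i′ j′ q → i ≡ i′ ⊎ i ≡ j′
  pair-overlap {i} {j} {i′} {j′} eq
    with x∈p∪q⁻ ⁅ i′ ⁆ ⁅ j′ ⁆ (subst (i ∈_) (cong proj₁ eq) (p⊆p∪q ⁅ j ⁆ (x∈⁅x⁆ i)))
  ... | inj₁ i∈ = inj₁ (x∈⁅y⁆⇒x≡y i′ i∈)
  ... | inj₂ i∈ = inj₂ (x∈⁅y⁆⇒x≡y j′ i∈)

  edge₁ : ∀ i j i≢j → single i ~ pair i j i≢j
  edge₁ i j i≢j = ⁅h⁆≢⁅i⁆∪⁅j⁆ i≢j , inj₁ (p⊆p∪q ⁅ j ⁆)

  edge₂ : ∀ i j i≢j → single j ~ pair i j i≢j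
  edge₂ i j i≢j = ⁅h⁆≢⁅i⁆∪⁅j⁆ i≢j , inj₁ (q⊆p∪q ⁅ i ⁆ ⁅ j ⁆)

  module _ {s} (B : BookDrawing (G k) s) where
    open BookDrawing B
    open Spine B

    layer₁ layer₂ : ∀ i j → i ≢ j → Fin s
    layer₁ i j i≢j = layer {single i} {pair i j i≢j} (edge₁ i j i≢j)
    layer₂ i j i≢j = layer {single j} {pair i j i≢j} (edge₂ i j i≢j)

    -- Two arcs of the same kind with distinct a's and distinct b's have no common end, so lying in
    -- one page makes them unlinked, as `K₃₃` requires.
    no-monochromatic-K₃₃ : (X Y : Fin 3 → Fin k) →
      Injective _≡_ _≡_ X → Injective _≡_ _≡_ Y → (X≢Y : ∀ a b → X a ≢ Y b) →
      (∀ a b a′ b′ → layer₁ (X a) (Y b) (X≢Y a b) ≡ layer₁ (X a′) (Y b′) (X≢Y a′ b′)) →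
      (∀ a b a′ b′ → layer₂ (X a) (Y b) (X≢Y a b) ≡ layer₂ (X a′) (Y b′) (X≢Y a′ b′)) →
      ⊥
    no-monochromatic-K₃₃ X Y X-inj Y-inj X≢Y mono₁ mono₂ = not-two-page
      where
      m : Fin 3 → Fin 3 → V
      m a b = pair (X a) (Y b) (X≢Y a b)

      m≢m : ∀ {a a′ b b′} → a ≢ a′ → m a b ≢ m a′ b′
      m≢m {a} {a′} {b} {b′} a≢a′ eq with pair-overlap eq
      ... | inj₁ X≡X = a≢a′ (X-inj X≡X)
      ... | inj₂ X≡Y = X≢Y a b′ X≡Y

      open K₃₃ (single ∘ X) (single ∘ Y) m
        (λ b≢b′ → b≢b′ ∘ Y-inj ∘ single-injective) single≢pair
        (λ {a} {a′} {b} {b′} a≢a′ b≢b′ →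
          unlinked {single (X a)} {m a b} {single (X a′)} {m a′ b′}
            (edge₁ (X a) (Y b) (X≢Y a b)) (edge₁ (X a′) (Y b′) (X≢Y a′ b′))
            (mono₁ a b a′ b′) (a≢a′ ∘ X-inj ∘ single-injective)
            single≢pair (single≢pair ∘ sym) (m≢m a≢a′))
        (λ {a} {a′} {b} {b′} a≢a′ b≢b′ →
          unlinked {single (Y b)} {m a b} {single (Y b′)} {m a′ b′}
            (edge₂ (X a) (Y b) (X≢Y a b)) (edge₂ (X a′) (Y b′) (X≢Y a′ b′))
            (mono₂ a b a′ b′) (b≢b′ ∘ Y-inj ∘ single-injective)
            single≢pair (single≢pair ∘ sym) (m≢m a≢a′))

-- Given fewer than `t` pages, colour each edge between the two parts by the pages of its two
-- halves. The pages are embedded in `Fin t` because `l` and `r` are fixed before the number `s` of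
-- pages is known.
forces-K₃₃⇒≤bt : ∀ {t l r} → Forces-K₃₃ l r (t ℕ.* t) → t ≤bt G (ℕ.suc (l ℕ.+ r))
forces-K₃₃⇒≤bt {t} {l} {r} find {s} B = ℕ.≮⇒≥ λ s<t →
  let s≤t = ℕ.<⇒≤ s<t
      g , h , κ , g-inj , h-inj , mono =
        find (λ a b → combine (inject≤ (page₁ a b) s≤t) (inject≤ (page₂ a b) s≤t))
      same a b a′ b′ = Fin.combine-injective _ _ _ _ (trans (mono a b) (sym (mono a′ b′)))
  in no-monochromatic-K₃₃ B (left ∘ g) (right ∘ h)
       (g-inj ∘ Fin.↑ˡ-injective r _ _ ∘ Fin.suc-injective)
       (h-inj ∘ Fin.↑ʳ-injective l _ _ ∘ Fin.suc-injective)
       (λ a b → left≢right (g a) (h b))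
       (λ a b a′ b′ → Fin.inject≤-injective s≤t s≤t
         (page₁ (g a) (h b)) (page₁ (g a′) (h b′)) (proj₁ (same a b a′ b′)))
       (λ a b a′ b′ → Fin.inject≤-injective s≤t s≤t
         (page₂ (g a) (h b)) (page₂ (g a′) (h b′)) (proj₂ (same a b a′ b′)))
  where
  -- The vertex `zero` stays outside both parts; it makes the number of vertices a successor, hence
  -- positive.
  left : Fin l → Fin (ℕ.suc (l ℕ.+ r))
  left a = suc (a ↑ˡ r)

  right : Fin r → Fin (ℕ.suc (l ℕ.+ r))
  right b = suc (l ↑ʳ b)

  left≢right : ∀ a b → left a ≢ right b
  left≢right a b eq with trans (sym (Fin.splitAt-↑ˡ l a r))
    (trans (cong (splitAt l) (Fin.suc-injective eq)) (Fin.splitAt-↑ʳ l r b))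
  ... | ()

  page₁ page₂ : Fin l → Fin r → Fin s
  page₁ a b = layer₁ B (left a) (right b) (left≢right a b)
  page₂ a b = layer₂ B (left a) (right b) (left≢right a b)

theorem2 : ∀ (t : ℕ) → 0 <ℕ t → ∃[ k ] (0 <ℕ k × t ≤bt G k)
theorem2 t _ =
  let l , r , find = monochromatic-K₃₃ (t ℕ.* t)
  in ℕ.suc (l ℕ.+ r) , ℕ.s≤s ℕ.z≤n , forces-K₃₃⇒≤bt {t} find
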